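{- Let $G$ and $H$ be graphs, each with at least $2$ vertices. The Cartesian product $G \Box H$ is $1$-perfectly orientable if and only if one of the following holds: (i) $G$ is edgeless and $H$ is $1$-perfectly orientable, or vice versa (i.e. $H$ is edgeless and $G$ is $1$-perfectly orientable); (ii) $G\cong pK_1+qK_2$ and $H\cong rK_1+sK_2$ for some integers $p,q,r,s\ge 0$.
   Context: All graphs are finite and simple. An orientation of a graph $G$ is $1$-perfect if the out-neighborhood of every vertex induces a clique in $G$; $G$ is $1$-perfectly orientable ($1$-p.o.) if it admits a $1$-perfect orientation. The Cartesian product $G\Box H$ has vertex set $V(G)\times V(H)$, with distinct $(u,v),(u',v')$ adjacent iff either $u=u'$ and $vv'\in E(H)$, or $v=v'$ and $uu'\in E(G)$. $G+H$ denotes disjoint union and $kG$ the disjoint union of $k$ copies of $G$; $K_n$ is the complete graph on $n$ vertices. -}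

module Defs where

open import Data.Fin using (Fin)
open import Data.Fin.Properties using (+↔⊎; *↔×) renaming (_≟_ to _≟ᶠ_)
open import Data.Nat using (ℕ; _+_; _*_)
open import Data.Product using (Σ-syntax; _×_; _,_)
open import Data.Product.Function.NonDependent.Propositional using (_×-↔_)
open import Data.Sum using (_⊎_; inj₁; inj₂)
open import Data.Sum.Function.Propositional using (_⊎-↔_)
open import Data.Sum.Relation.Binary.Pointwise using (Pointwise; inj₁; inj₂; ⊎-symmetric; ⊎-decidable)
open import Function.Bundles using (_↔_; _⇔_; Inverse)
open import Function.Construct.Composition using (_↔-∘_)
open import Function.Construct.Identity using (↔-id)
open import Function.Construct.Symmetry using (↔-sym)
open import Function.Properties.Inverse using (↔⇒↣)
open import Level using (0ℓ)
open import Relation.Binary.Core using (Rel)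
open import Relation.Binary.Definitions using (Decidable; DecidableEquality; Symmetric)
open import Relation.Binary.PropositionalEquality using (_≡_; _≢_; refl; sym)
open import Relation.Nullary using (¬_; ¬?; _×-dec_; _⊎-dec_)
open import Relation.Nullary.Decidable using (via-injection)
open import Relation.Unary using (Pred)

-- Decidability of adjacency is part of being a finite graph constructively;
-- classically it is no restriction.
record Graph : Set₁ where
  infix 4 _~_ _~?_ _≟_
  field
    V        : Set
    order    : ℕ
    finite   : V ↔ Fin order
    _~_      : Rel V 0ℓ
    _~?_     : Decidable _~_
    ~-sym    : Symmetric _~_
    ~-irrefl : ∀ {v} → ¬ (v ~ v)

  _≟_ : DecidableEquality V
  _≟_ = via-injection (↔⇒↣ finite) _≟ᶠ_

open Graph using (V)

infix 4 _≅_

record _≅_ (G H : Graph) : Set where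
  private
    module G = Graph G
    module H = Graph H
  field
    bij : G.V ↔ H.V
    adj : ∀ u v → (u G.~ v) ⇔ (Inverse.to bij u H.~ Inverse.to bij v)

Edgeless : Graph → Set
Edgeless G = ∀ u v → ¬ (u ~ v)
  where open Graph G

IsClique : (G : Graph) → Pred (V G) 0ℓ → Set
IsClique G S = ∀ {u v} → S u → S v → u ≢ v → u ~ v
  where open Graph G

-- Every edge gets exactly one of its two directions, and there are no other
-- arcs.  Decidability of _⟶_ follows from that of adjacency.
record Orientation (G : Graph) : Set₁ where
  open Graph G using (_~_)
  infix 4 _⟶_
  field
    _⟶_    : Rel (V G) 0ℓ
    ⟶⇒~    : ∀ {u v} → u ⟶ v → u ~ v
    total  : ∀ {u v} → u ~ v → (u ⟶ v) ⊎ (v ⟶ u)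
    asym   : ∀ {u v} → u ⟶ v → ¬ (v ⟶ u)

  outNeighborhood : V G → Pred (V G) 0ℓ
  outNeighborhood u v = u ⟶ v

1-Perfect : {G : Graph} → Orientation G → Set
1-Perfect {G} O = ∀ v → IsClique G (Orientation.outNeighborhood O v)

1-PerfectlyOrientable : Graph → Set₁
1-PerfectlyOrientable G = Σ[ O ∈ Orientation G ] 1-Perfect O

K : ℕ → Graph
K n = record
  { V        = Fin n
  ; order    = n
  ; finite   = ↔-id (Fin n)
  ; _~_      = _≢_
  ; _~?_     = λ u v → ¬? (u ≟ᶠ v)
  ; ~-sym    = λ u≢v v≡u → u≢v (sym v≡u)
  ; ~-irrefl = λ v≢v → v≢v refl
  }

infixr 6 _⊕_
infixr 7 _·_ _□_

-- Disjoint union G + H.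
_⊕_ : Graph → Graph → Graph
G ⊕ H = record
  { V        = G.V ⊎ H.V
  ; order    = G.order + H.order
  ; finite   = ↔-sym +↔⊎ ↔-∘ (G.finite ⊎-↔ H.finite)
  ; _~_      = Pointwise G._~_ H._~_
  ; _~?_     = ⊎-decidable G._~?_ H._~?_
  ; ~-sym    = ⊎-symmetric G.~-sym H.~-sym
  ; ~-irrefl = λ { (inj₁ p) → G.~-irrefl p ; (inj₂ p) → H.~-irrefl p }
  }
  where
  module G = Graph G
  module H = Graph H

-- The vertex (i , v) of k · G is the vertex v in the i-th copy of G.
_·_ : ℕ → Graph → Graph
k · G = record
  { V        = Fin k × G.V
  ; order    = k * G.order
  ; finite   = ↔-sym *↔× ↔-∘ (↔-id (Fin k) ×-↔ G.finite)
  ; _~_      = λ (i , u) (j , v) → i ≡ j × u G.~ v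
  ; _~?_     = λ (i , u) (j , v) → (i ≟ᶠ j) ×-dec (u G.~? v)
  ; ~-sym    = λ (i≡j , u~v) → sym i≡j , G.~-sym u~v
  ; ~-irrefl = λ (_ , v~v) → G.~-irrefl v~v
  }
  where module G = Graph G

-- Distinctness of adjacent pairs is automatic, by irreflexivity of the factors.
_□_ : Graph → Graph → Graph
G □ H = record
  { V        = G.V × H.V
  ; order    = G.order * H.order
  ; finite   = ↔-sym *↔× ↔-∘ (G.finite ×-↔ H.finite)
  ; _~_      = λ (u , v) (u′ , v′) → (u ≡ u′ × v H.~ v′) ⊎ (v ≡ v′ × u G.~ u′)
  ; _~?_     = λ (u , v) (u′ , v′) →
                 ((u G.≟ u′) ×-dec (v H.~? v′)) ⊎-dec ((v H.≟ v′) ×-dec (u G.~? u′))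
  ; ~-sym    = λ { (inj₁ (e , p)) → inj₁ (sym e , H.~-sym p)
                 ; (inj₂ (e , p)) → inj₂ (sym e , G.~-sym p) }
  ; ~-irrefl = λ { (inj₁ (_ , p)) → H.~-irrefl p
                 ; (inj₂ (_ , p)) → G.~-irrefl p }
  }
  where
  module G = Graph G
  module H = Graph H

{-# OPTIONS --safe #-}

-- At a vertex (u , x) of an orientation of G □ H whose out-neighbourhoods are
-- cliques, a G-arc and an H-arc cannot both leave, as their heads are not
-- adjacent; so every square u u′ × x x′ is oriented cyclically.  If x ~ y in H
-- and u has two neighbours a, b in G, the squares on {u , a} and {u , b} share
-- the edge over u, say (u , x) ⟶ (u , y); hence (u , y) ⟶ (a , y) ⟶ (a , x) and
-- (u , y) ⟶ (b , y) ⟶ (b , x).  Thus a ~ b, but neither direction of the edge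
-- between (a , y) and (b , y) is possible.  So if both factors have edges, both
-- have maximum degree at most 1.  Conversely, the product of two 2-coloured
-- graphs of maximum degree at most 1 has components K₁, K₂ and C₄, and the
-- colours select a cyclic orientation of each C₄.
module Submission where

open import Defs
open import Data.Bool using (Bool; true; false; not)
import Data.Bool.Properties as Bool
open import Data.Empty using (⊥-elim)
open import Data.Fin using (Fin; zero; suc; fromℕ<) renaming (_<_ to _<ᶠ_)
open import Data.Fin.Properties using (any?; <-cmp; <-asym)
  renaming (_<?_ to _<ᶠ?_)
open import Data.List using (List; allFin; filter; length; lookup; map)
open import Data.List.Membership.Propositional using (_∈_)
open import Data.List.Membership.Propositional.Properties
  using (∈-allFin; ∈-filter⁺; ∈-filter⁻; ∈-lookup; ∈-map⁺)
import Data.List.Relation.Unary.All as All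
open import Data.List.Relation.Unary.AllPairs using (_∷_)
open import Data.List.Relation.Unary.Any using (index)
open import Data.List.Relation.Unary.Any.Properties using (lookup-index)
open import Data.List.Relation.Unary.Unique.Propositional using (Unique)
open import Data.List.Relation.Unary.Unique.Propositional.Properties
  using (allFin⁺; filter⁺; map⁺)
open import Data.Nat using (ℕ; _≤_; z≤n; s≤s)
open import Data.Nat.Properties using (≤-trans)
open import Data.Product using (∃-syntax; _×_; _,_; proj₁; proj₂; swap)
open import Data.Sum as Sum using (_⊎_; inj₁; inj₂)
open import Data.Sum.Relation.Binary.Pointwise using (inj₁; inj₂)
open import Function using (_∘_)
open import Function.Bundles using (_⇔_; mk⇔; mk↔ₛ′; Equivalence; Inverse)
open import Function.Definitions using (Injective)
open import Level using (0ℓ)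
open import Relation.Binary.Definitions using (tri<; tri≈; tri>)
open import Relation.Binary.PropositionalEquality
  using (_≡_; _≢_; refl; sym; trans; cong; subst; subst₂)
open import Relation.Nullary using (¬_; Dec; yes; no; ¬?; _×-dec_; contradiction)
open import Relation.Nullary.Decidable using (map′)
open import Relation.Unary using (Pred; Decidable)

open Graph using (V; order)

-- Induced embeddings and restriction of orientations.

record _↪_ (G H : Graph) : Set where
  private
    module G = Graph G
    module H = Graph H
  field
    to        : V G → V H
    injective : Injective _≡_ _≡_ to
    preserves : ∀ {u v} → u G.~ v → to u H.~ to v
    reflects  : ∀ {u v} → to u H.~ to v → u G.~ v

≅⇒↪ : ∀ {G H} → G ≅ H → G ↪ H
≅⇒↪ G≅H = record
  { to        = Inverse.to bij
  ; injective = λ {u} {v} e → trans (sym (Inverse.strictlyInverseʳ bij u))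
                  (trans (cong (Inverse.from bij) e) (Inverse.strictlyInverseʳ bij v))
  ; preserves = λ {u} {v} → Equivalence.to (adj u v)
  ; reflects  = λ {u} {v} → Equivalence.from (adj u v)
  }
  where open _≅_ G≅H

↪-surjective⇒≅ : ∀ {G H} (f : H ↪ G) → (∀ v → ∃[ x ] _↪_.to f x ≡ v) → G ≅ H
↪-surjective⇒≅ {G} {H} f surj = record
  { bij = mk↔ₛ′ from to (λ x → injective (to∘from (to x))) to∘from
  ; adj = λ u v → mk⇔
      (λ u~v → reflects (subst₂ G._~_ (sym (to∘from u)) (sym (to∘from v)) u~v))
      (λ u~v → subst₂ G._~_ (to∘from u) (to∘from v) (preserves u~v))
  }
  where
  module G = Graph G
  open _↪_ f
  from    = proj₁ ∘ surj
  to∘from = proj₂ ∘ surj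

-- Restrict the orientation to an induced subgraph: injectivity keeps distinct heads distinct, and
-- `reflects` pulls their adjacency back.
1-po-↪ : ∀ {G H} → G ↪ H → 1-PerfectlyOrientable H → 1-PerfectlyOrientable G
1-po-↪ f (O , perfect) =
  record
    { _⟶_ = λ u v → to u ⟶ to v
    ; ⟶⇒~ = reflects ∘ ⟶⇒~
    ; total = total ∘ preserves
    ; asym = asym
    }
  , λ v p q u≢w → reflects (perfect (to v) p q (u≢w ∘ injective))
  where
  open _↪_ f
  open Orientation O

-- Symmetry and fibres of the product; an edgeless factor.

□-swap : ∀ G H → (G □ H) ↪ (H □ G)
□-swap G H = record
  { to        = swap
  ; injective = cong swap
  ; preserves = λ { (inj₁ p) → inj₂ p ; (inj₂ p) → inj₁ p }
  ; reflects  = λ { (inj₁ p) → inj₂ p ; (inj₂ p) → inj₁ p }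
  }

□-fibre : ∀ G H → V G → H ↪ (G □ H)
□-fibre G H u = record
  { to        = u ,_
  ; injective = cong proj₂
  ; preserves = λ p → inj₁ (refl , p)
  ; reflects  = λ { (inj₁ (_ , p)) → p
                  ; (inj₂ (_ , p)) → ⊥-elim (Graph.~-irrefl G p) }
  }

-- The product is a disjoint union of copies of `H`, one over each vertex of `G`; orient every copy
-- by `O`.
1-po-edgeless-□ : ∀ G H → Edgeless G → 1-PerfectlyOrientable H →
                  1-PerfectlyOrientable (G □ H)
1-po-edgeless-□ G H edgeless (O , perfect) =
  record
    { _⟶_ = λ (u , x) (v , y) → u ≡ v × x ⟶ y
    ; ⟶⇒~ = λ (e , p) → inj₁ (e , ⟶⇒~ p)
    ; total = λ { (inj₁ (refl , p)) → Sum.map (refl ,_) (refl ,_) (total p)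
                ; (inj₂ (_ , p)) → ⊥-elim (edgeless _ _ p) }
    ; asym = λ (_ , p) (_ , q) → asym p q
    }
  , λ { (u , x) (refl , p) (refl , q) ne →
        inj₁ (refl , perfect x p q (ne ∘ cong (u ,_))) }
  where open Orientation O

-- Products of two graphs of maximum degree at most 1.

Matching : Graph → Set
Matching G = ∀ {u v w} → u ~ v → u ~ w → v ≡ w
  where open Graph G

ProperColouring : (G : Graph) → (V G → Bool) → Set
ProperColouring G c = ∀ {u v} → u ~ v → c u ≡ not (c v)
  where open Graph G

Matching-↪ : ∀ {G H} → G ↪ H → Matching H → Matching G
Matching-↪ f matching p q = injective (matching (preserves p) (preserves q))
  where open _↪_ f

-- A G-arc leaves (u , x) when the colours of u and x agree, an H-arc when they
-- differ.
1-po-matching-□ : ∀ G H {c d} → Matching G → Matching H →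
                  ProperColouring G c → ProperColouring H d →
                  1-PerfectlyOrientable (G □ H)
1-po-matching-□ G H {c} {d} matchG matchH properG properH =
  record { _⟶_ = _⟶_ ; ⟶⇒~ = ⟶⇒~ ; total = total ; asym = asym } , perfect
  where
  module G = Graph G
  module H = Graph H
  module □ = Graph (G □ H)

  _⟶_ : V (G □ H) → V (G □ H) → Set
  (u , x) ⟶ (v , y) = (u ≡ v × x H.~ y × c u ≡ not (d x))
                    ⊎ (x ≡ y × u G.~ v × c u ≡ d x)

  ⟶⇒~ : ∀ {a b} → a ⟶ b → a □.~ b
  ⟶⇒~ (inj₁ (e , p , _)) = inj₁ (e , p)
  ⟶⇒~ (inj₂ (e , p , _)) = inj₂ (e , p)

  -- Along an edge one coordinate changes colour and the other is kept, so the colour test for that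
  -- kind of edge passes at exactly one end. The same fact gives `asym`.
  total : ∀ {a b} → a □.~ b → (a ⟶ b) ⊎ (b ⟶ a)
  total {u , x} {_ , y} (inj₁ (refl , p)) with c u Bool.≟ not (d x)
  ... | yes e = inj₁ (inj₁ (refl , p , e))
  ... | no ne = inj₂ (inj₁ (refl , H.~-sym p ,
                  trans (Bool.¬-not ne) (trans (Bool.not-involutive (d x)) (properH p))))
  total {u , x} {v , _} (inj₂ (refl , p)) with c u Bool.≟ d x
  ... | yes e = inj₁ (inj₂ (refl , p , e))
  ... | no ne = inj₂ (inj₂ (refl , G.~-sym p ,
                  Bool.not-injective (trans (sym (properG p)) (Bool.¬-not ne))))

  asym : ∀ {a b} → a ⟶ b → ¬ (b ⟶ a)
  asym (inj₁ (refl , p , e)) (inj₁ (_ , _ , e′)) =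
    Bool.not-¬ (Bool.not-injective (trans (sym e) e′)) (properH p)
  asym (inj₁ (_ , p , _)) (inj₂ (refl , _)) = H.~-irrefl p
  asym (inj₂ (_ , p , _)) (inj₁ (refl , _)) = G.~-irrefl p
  asym (inj₂ (refl , p , e)) (inj₂ (_ , _ , e′)) =
    Bool.not-¬ (trans e (sym e′)) (properG p)

  -- Every out-neighbourhood has at most one vertex: the colours at the tail allow only one kind of
  -- arc, and the matching condition allows only one head of that kind.
  perfect : ∀ a → IsClique (G □ H) (a ⟶_)
  perfect _ (inj₁ (refl , p , _)) (inj₁ (refl , q , _)) ne =
    contradiction (cong (_ ,_) (matchH p q)) ne
  perfect _ (inj₁ (_ , _ , e)) (inj₂ (_ , _ , e′)) _ = contradiction e (Bool.not-¬ e′)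
  perfect _ (inj₂ (_ , _ , e)) (inj₁ (_ , _ , e′)) _ = contradiction e′ (Bool.not-¬ e)
  perfect _ (inj₂ (refl , p , _)) (inj₂ (refl , q , _)) ne =
    contradiction (cong (_, _) (matchG p q)) ne

-- Copies of K₁ and K₂ as 2-coloured matchings.

pK₁+qK₂ : ℕ → ℕ → Graph
pK₁+qK₂ p q = (p · K 1) ⊕ (q · K 2)

other : Fin 2 → Fin 2
other zero       = suc zero
other (suc zero) = zero

≢⇒other : ∀ {i j} → i ≢ j → j ≡ other i
≢⇒other {zero}     {zero}     ne = contradiction refl ne
≢⇒other {zero}     {suc zero} _  = refl
≢⇒other {suc zero} {zero}     _  = refl
≢⇒other {suc zero} {suc zero} ne = contradiction refl ne

other-≢ : ∀ i → i ≢ other i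
other-≢ zero       ()
other-≢ (suc zero) ()

Fin1-≡ : (i j : Fin 1) → i ≡ j
Fin1-≡ zero zero = refl

pK₁+qK₂-matching : ∀ p q → Matching (pK₁+qK₂ p q)
pK₁+qK₂-matching p q (inj₁ (_ , ne)) _ = contradiction (Fin1-≡ _ _) ne
pK₁+qK₂-matching p q (inj₂ (refl , ne)) (inj₂ (refl , ne′)) =
  cong (λ i → inj₂ (_ , i)) (trans (≢⇒other ne) (sym (≢⇒other ne′)))

pK₁+qK₂-colour : ∀ p q → V (pK₁+qK₂ p q) → Bool
pK₁+qK₂-colour p q (inj₁ _)              = false
pK₁+qK₂-colour p q (inj₂ (_ , zero))     = false
pK₁+qK₂-colour p q (inj₂ (_ , suc zero)) = true

pK₁+qK₂-proper : ∀ p q → ProperColouring (pK₁+qK₂ p q) (pK₁+qK₂-colour p q)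
pK₁+qK₂-proper p q (inj₁ (_ , ne)) = contradiction (Fin1-≡ _ _) ne
pK₁+qK₂-proper p q (inj₂ {_ , zero}     {_ , _} (refl , ne)) rewrite ≢⇒other ne = refl
pK₁+qK₂-proper p q (inj₂ {_ , suc zero} {_ , _} (refl , ne)) rewrite ≢⇒other ne = refl

1-po-pK₁+qK₂-□ : ∀ {G H p q r s} → G ≅ pK₁+qK₂ p q → H ≅ pK₁+qK₂ r s →
                 1-PerfectlyOrientable (G □ H)
1-po-pK₁+qK₂-□ {G} {H} {p} {q} {r} {s} G≅ H≅ =
  1-po-matching-□ G H
    (Matching-↪ f (pK₁+qK₂-matching p q)) (Matching-↪ g (pK₁+qK₂-matching r s))
    -- The colourings of `G` and `H` are the standard ones pulled back along `f` and `g`.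
    (pK₁+qK₂-proper p q ∘ _↪_.preserves f) (pK₁+qK₂-proper r s ∘ _↪_.preserves g)
  where
  f = ≅⇒↪ G≅
  g = ≅⇒↪ H≅

-- Squares in a 1-perfectly oriented product.

module _ (G H : Graph) (O : Orientation (G □ H)) (perfect : 1-Perfect O) where
  private
    module G = Graph G
    module H = Graph H
    module O = Orientation O
    open O using (_⟶_)

  -- The two heads differ in both coordinates, whereas adjacent vertices of the product share one.
  ¬⟶-both : ∀ {u v x y} → u G.~ v → x H.~ y →
            (u , x) ⟶ (v , x) → ¬ ((u , x) ⟶ (u , y))
  ¬⟶-both u~v x~y p q
    with perfect _ p q (λ { refl → G.~-irrefl u~v })
  ... | inj₁ (refl , _) = G.~-irrefl u~v
  ... | inj₂ (refl , _) = H.~-irrefl x~y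

  G-arc⇒H-arc : ∀ {u v x y} → u G.~ v → x H.~ y →
                (u , x) ⟶ (v , x) → (u , y) ⟶ (u , x)
  G-arc⇒H-arc u~v x~y p with O.total (inj₁ (refl , x~y))
  ... | inj₁ q = contradiction q (¬⟶-both u~v x~y p)
  ... | inj₂ q = q

  H-arc⇒G-arc : ∀ {u v x y} → u G.~ v → x H.~ y →
                (u , x) ⟶ (u , y) → (v , x) ⟶ (u , x)
  H-arc⇒G-arc u~v x~y q with O.total (inj₂ (refl , u~v))
  ... | inj₁ p = contradiction q (¬⟶-both u~v x~y p)
  ... | inj₂ p = p

  -- Walk backwards around the square: the H-arc leaving `(u , x)` forces the G-edge there to enter
  -- from `(v , x)`, and this G-arc forces the H-edge at `(v , x)` to enter too.
  square-H-arc : ∀ {u v x y} → u G.~ v → x H.~ y →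
                 (u , x) ⟶ (u , y) → (v , y) ⟶ (v , x)
  square-H-arc u~v x~y p = G-arc⇒H-arc (G.~-sym u~v) x~y (H-arc⇒G-arc u~v x~y p)

  square-G-arc : ∀ {u v x y} → u G.~ v → x H.~ y →
                 (u , x) ⟶ (u , y) → (u , y) ⟶ (v , y)
  square-G-arc u~v x~y p =
    H-arc⇒G-arc (G.~-sym u~v) (H.~-sym x~y) (square-H-arc u~v x~y p)

  ¬two-neighbours : ∀ {u a b x y} → u G.~ a → u G.~ b → a ≢ b → x H.~ y →
                    ¬ ((u , x) ⟶ (u , y))
  ¬two-neighbours u~a u~b a≢b x~y p
    with perfect _ (square-G-arc u~a x~y p) (square-G-arc u~b x~y p) (a≢b ∘ cong proj₁)
  ... | inj₁ (a≡b , _) = a≢b a≡b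
  -- The tail of this edge, `(a , y)` or `(b , y)`, already sends an H-arc to its copy over `x`, so
  -- a G-arc cannot leave it as well.
  ... | inj₂ (_ , a~b) with O.total (inj₂ (refl , a~b))
  ...   | inj₁ q = ¬⟶-both a~b (H.~-sym x~y) q (square-H-arc u~a x~y p)
  ...   | inj₂ q = ¬⟶-both (G.~-sym a~b) (H.~-sym x~y) q (square-H-arc u~b x~y p)

  1-perfect-□⇒matching : ∀ {x y} → x H.~ y → Matching G
  1-perfect-□⇒matching x~y {u} {a} {b} u~a u~b with a G.≟ b
  ... | yes a≡b = a≡b
  ... | no  a≢b with O.total {u , _} (inj₁ (refl , x~y))
  ...   | inj₁ p = ⊥-elim (¬two-neighbours u~a u~b a≢b x~y p)
  ...   | inj₂ p = ⊥-elim (¬two-neighbours u~a u~b a≢b (H.~-sym x~y) p)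

-- Enumeration of vertex sets and decomposition of a matching.

lookup-injective : ∀ {A : Set} {xs : List A} → Unique xs → Injective _≡_ _≡_ (lookup xs)
lookup-injective (_ ∷ _)  {zero}  {zero}  _ = refl
lookup-injective (x∉ ∷ _) {zero}  {suc j} e = contradiction e (All.lookup x∉ (∈-lookup j))
lookup-injective (x∉ ∷ _) {suc i} {zero}  e = contradiction (sym e) (All.lookup x∉ (∈-lookup i))
lookup-injective (_ ∷ us) {suc i} {suc j} e = cong suc (lookup-injective us e)

-- A bijection from `Fin size` onto the elements satisfying `P`, phrased with elements of `A` rather
-- than pairs so that proofs of `P` are never compared.
record Enumeration {A : Set} (P : Pred A 0ℓ) : Set where
  field
    size      : ℕ
    elem      : Fin size → A
    injective : Injective _≡_ _≡_ elem
    sound     : ∀ i → P (elem i)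
    complete  : ∀ {a} → P a → ∃[ i ] elem i ≡ a

module _ (G : Graph) where
  open Graph G hiding (V; order)

  private
    position = Inverse.to finite
    vertex   = Inverse.from finite

    vertex-position : ∀ v → vertex (position v) ≡ v
    vertex-position = Inverse.strictlyInverseʳ finite

  position-injective : Injective _≡_ _≡_ position
  position-injective {u} {v} e =
    trans (sym (vertex-position u)) (trans (cong vertex e) (vertex-position v))

  vertex-injective : Injective _≡_ _≡_ vertex
  vertex-injective {i} {j} e = trans (sym (Inverse.strictlyInverseˡ finite i))
    (trans (cong position e) (Inverse.strictlyInverseˡ finite j))

  anyVertex? : ∀ {P : Pred (V G) 0ℓ} → Decidable P → Dec (∃[ v ] P v)
  anyVertex? {P} P? = map′ (λ (i , p) → vertex i , p)
    (λ (v , p) → position v , subst P (sym (vertex-position v)) p)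
    (any? (P? ∘ vertex))

  edge? : Dec (∃[ u ] ∃[ v ] u ~ v)
  edge? = anyVertex? (λ u → anyVertex? (u ~?_))

  enumerate : ∀ {P : Pred (V G) 0ℓ} → Decidable P → Enumeration P
  enumerate {P} P? = record
    { size      = length chosen
    ; elem      = lookup chosen
    ; injective = lookup-injective (filter⁺ P? (map⁺ vertex-injective (allFin⁺ _)))
    ; sound     = λ i → proj₂ (∈-filter⁻ P? {xs = vertices} (∈-lookup i))
    ; complete  = λ p → let v∈ = ∈-filter⁺ P? (∈vertices _) p
                        in index v∈ , sym (lookup-index v∈)
    }
    where
    vertices chosen : List (V G)
    vertices = map vertex (allFin (order G))
    chosen   = filter P? vertices
    ∈vertices : ∀ v → v ∈ vertices
    ∈vertices v = subst (_∈ vertices) (vertex-position v) (∈-map⁺ vertex (∈-allFin _))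

  -- The copies of K₂ are indexed by the endpoint that comes first in the given
  -- enumeration of the vertices.
  matching⇒pK₁+qK₂ : Matching G → ∃[ p ] ∃[ q ] G ≅ pK₁+qK₂ p q
  matching⇒pK₁+qK₂ matching = I.size , L.size , ↪-surjective⇒≅ embedding surjective
    where
    _≺_ : V G → V G → Set
    u ≺ v = position u <ᶠ position v

    Isolated Lower : Pred (V G) 0ℓ
    Isolated v = ¬ (∃[ w ] v ~ w)
    Lower v    = ∃[ w ] (v ~ w × v ≺ w)

    isolated : Enumeration Isolated
    isolated = enumerate (λ v → ¬? (anyVertex? (v ~?_)))

    lower : Enumeration Lower
    lower = enumerate (λ v → anyVertex? (λ w → (v ~? w) ×-dec (position v <ᶠ? position w)))

    module I = Enumeration isolated
    module L = Enumeration lower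
    T = pK₁+qK₂ I.size L.size
    module T = Graph T

    partner : Fin L.size → V G
    partner j = proj₁ (L.sound j)

    lower~partner : ∀ j → L.elem j ~ partner j
    lower~partner j = proj₁ (proj₂ (L.sound j))

    lower≺partner : ∀ j → L.elem j ≺ partner j
    lower≺partner j = proj₂ (proj₂ (L.sound j))

    to : V T → V G
    to (inj₁ (i , _))        = I.elem i
    to (inj₂ (j , zero))     = L.elem j
    to (inj₂ (j , suc zero)) = partner j

    to~to-other : ∀ j i → to (inj₂ (j , i)) ~ to (inj₂ (j , other i))
    to~to-other j zero       = lower~partner j
    to~to-other j (suc zero) = ~-sym (lower~partner j)

    -- Otherwise the matching condition makes edges `j` and `k` the same edge with its ends
    -- exchanged, and each end would precede the other.
    lower≢partner : ∀ j k → L.elem j ≢ partner k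
    lower≢partner j k e = <-asym (lower≺partner j)
      (subst₂ _≺_ (sym partner-j≡lower-k) (sym e) (lower≺partner k))
      where
      partner-j≡lower-k : partner j ≡ L.elem k
      partner-j≡lower-k = matching (lower~partner j)
        (subst (_~ L.elem k) (sym e) (~-sym (lower~partner k)))

    isolated≢ : ∀ i j k → I.elem i ≢ to (inj₂ (j , k))
    isolated≢ i j k e = I.sound i (_ , subst (_~ to (inj₂ (j , other k))) (sym e) (to~to-other j k))

    to-injective : Injective _≡_ _≡_ to
    to-injective {inj₁ (i , zero)} {inj₁ (j , zero)} e =
      cong (λ i → inj₁ (i , zero)) (I.injective e)
    to-injective {inj₁ (i , _)} {inj₂ (j , k)} e = contradiction e (isolated≢ i j k)
    to-injective {inj₂ (j , k)} {inj₁ (i , _)} e = contradiction (sym e) (isolated≢ i j k)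
    to-injective {inj₂ (j , zero)} {inj₂ (k , zero)} e =
      cong (λ j → inj₂ (j , zero)) (L.injective e)
    to-injective {inj₂ (j , zero)} {inj₂ (k , suc zero)} e =
      contradiction e (lower≢partner j k)
    to-injective {inj₂ (j , suc zero)} {inj₂ (k , zero)} e =
      contradiction (sym e) (lower≢partner k j)
    to-injective {inj₂ (j , suc zero)} {inj₂ (k , suc zero)} e =
      cong (λ j → inj₂ (j , suc zero)) (L.injective (matching
        (subst (_~ L.elem j) e (~-sym (lower~partner j))) (~-sym (lower~partner k))))

    preserves : ∀ {x y} → x T.~ y → to x ~ to y
    preserves (inj₁ (_ , ne)) = contradiction (Fin1-≡ _ _) ne
    preserves (inj₂ {j , i} {_ , _} (refl , ne)) rewrite ≢⇒other ne = to~to-other j i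

    -- The image of a K₂ vertex is adjacent to the image of its other end; by uniqueness of
    -- neighbours and injectivity, `y` is that other end.
    reflects : ∀ {x y} → to x ~ to y → x T.~ y
    reflects {inj₁ (i , _)} p = ⊥-elim (I.sound i (_ , p))
    reflects {inj₂ (j , i)} p =
      subst (inj₂ (j , i) T.~_) (to-injective (matching (to~to-other j i) p))
        (inj₂ (refl , other-≢ i))

    embedding : T ↪ G
    embedding = record
      { to = to ; injective = to-injective ; preserves = preserves ; reflects = reflects }

    surjective : ∀ v → ∃[ x ] to x ≡ v
    surjective v with anyVertex? (v ~?_)
    ... | no  none = let i , e = I.complete none in inj₁ (i , zero) , e
    ... | yes (w , v~w) with <-cmp (position v) (position w)
    ...   | tri< v≺w _ _ = let j , e = L.complete (w , v~w , v≺w) in inj₂ (j , zero) , e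
    ...   | tri≈ _ e _   = ⊥-elim (~-irrefl (subst (v ~_) (sym (position-injective e)) v~w))
    -- Here `w` is the lower end. The vertex `partner j` is whichever witness the enumeration
    -- stored, so uniqueness of neighbours identifies it with `v`.
    ...   | tri> _ _ w≺v = let j , e = L.complete (v , ~-sym v~w , w≺v) in
      inj₂ (j , suc zero) , matching (lower~partner j) (subst (_~ v) (sym e) (~-sym v~w))

  2≤order⇒vertex : 2 ≤ order G → V G
  2≤order⇒vertex 2≤n = vertex (fromℕ< (≤-trans (s≤s z≤n) 2≤n))

theorem7 : (G H : Graph) → 2 ≤ Graph.order G → 2 ≤ Graph.order H →
    1-PerfectlyOrientable (G □ H) ⇔
    (((Edgeless G × 1-PerfectlyOrientable H) ⊎ (Edgeless H × 1-PerfectlyOrientable G))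
    ⊎ (∃[ p ] ∃[ q ] ∃[ r ] ∃[ s ] (G ≅ (p · K 1) ⊕ (q · K 2)) × (H ≅ (r · K 1) ⊕ (s · K 2))))
theorem7 G H 2≤G 2≤H = mk⇔ necessary sufficient
  where
  necessary : 1-PerfectlyOrientable (G □ H) → _
  necessary po with edge? G | edge? H
  ... | no none | _ =
    inj₁ (inj₁ ((λ u v p → none (u , v , p))
               -- The order bound supplies a vertex of `G`, and the fibre over it is an induced copy
               -- of `H`.
               , 1-po-↪ (□-fibre G H (2≤order⇒vertex G 2≤G)) po))
  ... | yes _ | no none =
    inj₁ (inj₂ ((λ u v p → none (u , v , p))
               , 1-po-↪ (□-fibre H G (2≤order⇒vertex H 2≤H)) (1-po-↪ (□-swap H G) po)))
  ... | yes (_ , _ , u~v) | yes (_ , _ , x~y) =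
    -- An edge of either factor makes the other a matching; the swapped product lets one lemma serve
    -- both directions.
    let O  , perfect  = po
        O′ , perfect′ = 1-po-↪ (□-swap H G) po
        p , q , G≅    = matching⇒pK₁+qK₂ G (1-perfect-□⇒matching G H O perfect x~y)
        r , s , H≅    = matching⇒pK₁+qK₂ H (1-perfect-□⇒matching H G O′ perfect′ u~v)
    in inj₂ (p , q , r , s , G≅ , H≅)

  sufficient : _ → 1-PerfectlyOrientable (G □ H)
  sufficient (inj₁ (inj₁ (edgeless , po))) = 1-po-edgeless-□ G H edgeless po
  sufficient (inj₁ (inj₂ (edgeless , po))) =
    1-po-↪ (□-swap G H) (1-po-edgeless-□ H G edgeless po)
  sufficient (inj₂ (_ , _ , _ , _ , G≅ , H≅)) = 1-po-pK₁+qK₂-□ G≅ H≅
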